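{- Let $H$ be an oriented graph that does not contain a sink and let $z\in V(H)$ be such that $D=H-\{z\}$ is a tournament missing a matching. Then there exists a vertex in $V(D)$ that has a large second neighborhood in both $D$ and $H$.
   Context: All graphs are finite and simple. An oriented graph is a digraph without loops or digons. For a digraph $G$, $N_G^+(v)$ and $N_G^-(v)$ are the out- and in-neighborhoods of $v$; $N_G^{++}(v)=\{u\in V(G)\setminus(\{v\}\cup N_G^+(v)) : N_G^-(u)\cap N_G^+(v)\neq\emptyset\}$. A vertex $v$ has a large second neighborhood in $G$ if $|N_G^{++}(v)|\ge |N_G^+(v)|$. A sink is a vertex with out-degree zero. $H-\{z\}$ is the subgraph induced by $V(H)\setminus\{z\}$. A missing edge of an oriented graph is an unordered pair of distinct vertices with no arc between them. A tournament missing a matching is an oriented graph whose missing edges form a (possibly empty) matching, i.e. every vertex belongs to at most one missing edge. -}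

module Defs where

open import Data.Fin.Base using (Fin; punchIn)
open import Data.Fin.Subset using (Subset; Nonempty; ⁅_⁆; _∪_; _∩_; _∉_; ∣_∣)
open import Data.Fin.Subset.Properties using (_∈?_; nonempty?)
open import Data.Nat.Base using (ℕ; suc; _≥_)
open import Data.Product.Base using (_×_)
open import Data.Vec.Base using (tabulate)
open import Level using (0ℓ)
open import Relation.Binary.Core using (Rel)
open import Relation.Binary.Definitions using (Irreflexive; Asymmetric)
import Relation.Binary.Definitions as Binary
open import Relation.Binary.PropositionalEquality.Core using (_≡_; _≢_)
open import Relation.Nullary.Decidable.Core using (does; ¬?; _×-dec_)
open import Relation.Nullary.Negation.Core using (¬_)
open import Relation.Unary using (Pred; Decidable)

private
  variable
    n : ℕ

record Digraph (n : ℕ) : Set₁ where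
  infix 4 _⟶_ _⟶?_
  field
    _⟶_  : Rel (Fin n) 0ℓ
    _⟶?_ : Binary.Decidable _⟶_

⟪_⟫ : {P : Pred (Fin n) 0ℓ} → Decidable P → Subset n
⟪ P? ⟫ = tabulate (λ u → does (P? u))

module _ (G : Digraph n) where
  open Digraph G

  N⁺ : Fin n → Subset n
  N⁺ v = ⟪ (λ u → v ⟶? u) ⟫

  N⁻ : Fin n → Subset n
  N⁻ v = ⟪ (λ u → u ⟶? v) ⟫

  IsSecondOutNeighbour : Fin n → Pred (Fin n) 0ℓ
  IsSecondOutNeighbour v u = u ∉ ⁅ v ⁆ ∪ N⁺ v × Nonempty (N⁻ u ∩ N⁺ v)

  isSecondOutNeighbour? : ∀ v → Decidable (IsSecondOutNeighbour v)
  isSecondOutNeighbour? v u = ¬? (u ∈? ⁅ v ⁆ ∪ N⁺ v) ×-dec nonempty? (N⁻ u ∩ N⁺ v)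

  N⁺⁺ : Fin n → Subset n
  N⁺⁺ v = ⟪ isSecondOutNeighbour? v ⟫

  HasLargeSecondNeighbourhood : Fin n → Set
  HasLargeSecondNeighbourhood v = ∣ N⁺⁺ v ∣ ≥ ∣ N⁺ v ∣

  IsSink : Fin n → Set
  IsSink v = ∣ N⁺ v ∣ ≡ 0

  record IsOriented : Set where
    field
      noLoops  : Irreflexive _≡_ _⟶_
      noDigons : Asymmetric _⟶_

  MissingEdge : Rel (Fin n) 0ℓ
  MissingEdge u v = u ≢ v × ¬ (u ⟶ v) × ¬ (v ⟶ u)

  record IsTournamentMissingMatching : Set where
    field
      isOriented : IsOriented
      -- MissingEdge is symmetric, so the missing edges at v are exactly the
      -- pairs {v , x} with MissingEdge v x.
      matching   : ∀ v x y → MissingEdge v x → MissingEdge v y → x ≡ y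

-- The subgraph induced by deleting z.  Its vertices are renumbered by Fin n:
-- the vertex v of the result is the vertex punchIn z v of the original graph
-- (punchIn z is a bijection from Fin n onto the elements of Fin (suc n)
-- other than z).
_-[_] : Digraph (suc n) → Fin (suc n) → Digraph n
H -[ z ] = record
  { _⟶_  = λ u v → punchIn z u ⟶ punchIn z v
  ; _⟶?_ = λ u v → punchIn z u ⟶? punchIn z v
  }
  where open Digraph H

{-# OPTIONS --safe #-}
-- Write x ⇒ y for an arc of D or for a missing edge that is oriented from x to y
-- (see Oriented; some missing edges stay unoriented), and order V(D) so that the
-- number of forward pairs of ⇒ is maximal.  Moving single vertices forward never
-- improves the order, which gives |N⁺ f| ≤ |N⁺⁺ f| in D for the last vertex f.
-- If equality holds, then the order in which the vertices outside N⁺ f ∪ N⁺⁺ f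
-- come first, then f, then the others, is again optimal (sedimentation).
-- Let w be an out-neighbour of z.  If f fails in H, then f → z, equality holds
-- in D, and w lies in N⁺ f ∪ N⁺⁺ f (otherwise f → z → w would be a surplus
-- second out-neighbour), so sedimentation moves w strictly towards the end of
-- the order, which cannot go on forever.
module Submission where

open import Defs
open import Data.Bool.Base using (Bool; true; false)
open import Data.Empty using (⊥)
open import Data.Fin.Base using (Fin; zero; suc; punchIn; punchOut)
open import Data.Fin.Properties using (_≟_; any?; sequence; punchIn-injective; punchIn-punchOut)
open import Data.Fin.Subset using (Subset; ⁅_⁆; _∪_; _-_; ∣_∣; _⊆_; inside; outside)
  renaming (_∈_ to _∈ₛ_)
open import Data.Fin.Subset.Properties
  using (p⊆q⇒∣p∣≤∣q∣; p⊂q⇒∣p∣<∣q∣; x∈⁅x⁆; x∈⁅y⁆⇒x≡y; x∈p∪q⁺; x∈p∪q⁻; x∈p∩q⁺; x∈p∩q⁻;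
         x∈p∧x≢y⇒x∈p-y; x∈p⇒∣p-x∣<∣p∣; ∪-identityʳ; nonempty?; Empty-unique; ∣⊥∣≡0)
open import Data.List.Base
  using (List; []; _∷_; [_]; _++_; length; filter; allFin; initLast; _∷ʳ′_)
  renaming (tabulate to tabulateₗ)
open import Data.List.Membership.Propositional using (_∈_; _∉_)
open import Data.List.Membership.Propositional.Properties using (∈-allFin; ∈-filter⁻)
open import Data.List.Properties using (filter-++; length-++; length-filter; filter-reject; ++-assoc)
open import Data.List.Relation.Binary.Permutation.Propositional
  using (_↭_; ↭-refl; ↭-sym; ↭-trans; ↭⇒↭ₛ)
open import Data.List.Relation.Binary.Permutation.Propositional.Properties
  using (∈-resp-↭; ∷↭∷ʳ; ↭-length; filter-↭; shift; ++⁺ˡ)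
import Data.List.Relation.Binary.Permutation.Setoid.Properties as Permutation
open import Data.List.Relation.Unary.All as All using (All; []; _∷_)
open import Data.List.Relation.Unary.All.Properties using () renaming (++⁺ to All-++⁺)
open import Data.List.Relation.Unary.AllPairs using (_∷_)
open import Data.List.Relation.Unary.Any using (here; there)
open import Data.List.Relation.Unary.Unique.Propositional using (Unique)
open import Data.List.Relation.Unary.Unique.Propositional.Properties using (allFin⁺)
open import Data.Nat.Base using (ℕ; zero; suc; _+_; _*_; _≤_; _<_; z≤n; s≤s)
open import Data.Nat.Induction using (<-wellFounded)
open import Data.Nat.Properties hiding (_≟_)
open import Data.Nat.Tactic.RingSolver using (solve-∀)
open import Data.Product.Base using (_×_; _,_; proj₁; proj₂; ∃-syntax)
open import Data.Sum.Base using (_⊎_; inj₁; inj₂; [_,_]′)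
open import Data.Vec.Base using (tabulate; _∷_)
open import Data.Vec.Properties using (lookup∘tabulate; []=⇒lookup; lookup⇒[]=)
open import Effect.Monad using (RawMonad)
open import Function.Base using (_∘_; id)
open import Induction.WellFounded using (Acc; acc)
open import Level using (0ℓ)
open import Relation.Binary.Core using (Rel)
import Relation.Binary.Definitions as Binary
open import Relation.Binary.PropositionalEquality
  using (_≡_; _≢_; ≢-sym; refl; sym; trans; cong; cong₂; subst; subst₂; setoid; module ≡-Reasoning)
open import Relation.Nullary
  using (¬_; Dec; yes; no; does; ¬?; _×-dec_; _⊎-dec_; contradiction; ¬¬-excluded-middle)
open import Relation.Nullary.Decidable using (decidable-stable; dec-true)
open import Relation.Nullary.Negation using (¬¬-Monad)
open import Relation.Unary using (Pred; Decidable)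

private
  variable
    n : ℕ

-- Counting entries of lists, and positions counted from the end.

module _ {A : Set} where

  private
    variable
      P Q : Pred A 0ℓ

  # : Decidable P → List A → ℕ
  # P? = length ∘ filter P?

  #-++ : (P? : Decidable P) → ∀ xs ys → # P? (xs ++ ys) ≡ # P? xs + # P? ys
  #-++ P? xs ys = trans (cong length (filter-++ P? xs ys)) (length-++ (filter P? xs))

  #-↭ : (P? : Decidable P) → ∀ {xs ys} → xs ↭ ys → # P? xs ≡ # P? ys
  #-↭ P? = ↭-length ∘ filter-↭ P?

  #-mono : (P? : Decidable P) (Q? : Decidable Q) → ∀ {xs} → All (λ x → P x → Q x) xs → # P? xs ≤ # Q? xs
  #-mono P? Q? [] = z≤n
  #-mono P? Q? {x ∷ xs} (p⇒q ∷ ps) with P? x | Q? x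
  ... | yes p | yes q = s≤s (#-mono P? Q? ps)
  ... | yes p | no ¬q = contradiction (p⇒q p) ¬q
  ... | no ¬p | yes q = m≤n⇒m≤1+n (#-mono P? Q? ps)
  ... | no ¬p | no ¬q = #-mono P? Q? ps

  #-none : (P? : Decidable P) → ∀ {x} → ¬ P x → # P? [ x ] ≡ 0
  #-none P? ¬p = cong length (filter-reject P? ¬p)

  module _ (_≟_ : Binary.DecidableEquality A) where

    -- The measure of the final descent: it drops when `w` moves towards the end of an order. The
    -- value at the empty list is a default for an absent `w`.
    after : A → List A → ℕ
    after w []       = 0
    after w (x ∷ xs) with w ≟ x
    ... | yes _ = length xs
    ... | no  _ = after w xs

    after-∷ʳ : ∀ {w} f {xs} → w ∈ xs → after w (xs ++ [ f ]) ≡ suc (after w xs)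
    after-∷ʳ {w} f {x ∷ xs} w∈ with w ≟ x
    after-∷ʳ {w} f {x ∷ xs} w∈           | yes _   = trans (length-++ xs) (+-comm (length xs) 1)
    after-∷ʳ {w} f {x ∷ xs} (here w≡x)   | no w≢x = contradiction w≡x w≢x
    after-∷ʳ {w} f {x ∷ xs} (there w∈)   | no w≢x = after-∷ʳ f w∈

    after-++-∉ : ∀ {w} xs {ys} → w ∉ xs → after w (xs ++ ys) ≡ after w ys
    after-++-∉ []           w∉ = refl
    after-++-∉ {w} (x ∷ xs) w∉ with w ≟ x
    ... | yes w≡x = contradiction (here w≡x) w∉
    ... | no  _   = after-++-∉ xs (w∉ ∘ there)

    after-filter : (P? : Decidable P) → ∀ {w} → P w → ∀ xs → after w (filter P? xs) ≤ after w xs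
    after-filter P? Pw [] = z≤n
    after-filter P? {w} Pw (x ∷ xs) with P? x
    ... | yes Px with w ≟ x
    ...   | yes _ = length-filter P? xs
    ...   | no  _ = after-filter P? Pw xs
    after-filter P? {w} Pw (x ∷ xs) | no ¬Px with w ≟ x
    ...   | yes refl = contradiction Pw ¬Px
    ...   | no  _    = after-filter P? Pw xs

-- Median orders: maximal number of forward pairs.

module MedianOrder {A : Set} {_⇒_ : Rel A 0ℓ} (_⇒?_ : Binary.Decidable _⇒_) where

  forward : List A → ℕ
  forward []       = 0
  forward (x ∷ xs) = # (x ⇒?_) xs + forward xs

  forward-bounded : ∀ xs → forward xs ≤ length xs * length xs
  forward-bounded []       = z≤n
  forward-bounded (x ∷ xs) = +-mono-≤ (m≤n⇒m≤1+n (length-filter (x ⇒?_) xs))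
    (≤-trans (forward-bounded xs) (*-monoʳ-≤ (length xs) (n≤1+n _)))

  #-flip : ∀ x y → # (x ⇒?_) [ y ] ≡ # (_⇒? y) [ x ]
  #-flip x y with x ⇒? y
  ... | yes _ = refl
  ... | no  _ = refl

  -- Only the pairs formed by `x` and an entry of `ms` are reversed. The change is stated as an
  -- equality of sums to avoid subtraction.
  forward-move : ∀ ws ms x ys →
    forward (ws ++ ms ++ x ∷ ys) + # (x ⇒?_) ms ≡ forward (ws ++ x ∷ ms ++ ys) + # (_⇒? x) ms
  forward-move [] [] x ys = refl
  forward-move [] (m ∷ ms) x ys = begin
    # (m ⇒?_) (ms ++ x ∷ ys) + s + # (x ⇒?_) (m ∷ ms)
      ≡⟨ cong₂ (λ a b → a + s + b)
           (trans (#-++ (m ⇒?_) ms (x ∷ ys)) (cong (# (m ⇒?_) ms +_) (#-++ (m ⇒?_) [ x ] ys)))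
           (#-++ (x ⇒?_) [ m ] ms) ⟩
    (mM + (b + mY)) + s + (d + e)
      ≡⟨ lhs mM b mY s d e ⟩
    (d + mM + b + mY) + (s + e)
      ≡⟨ cong (d + mM + b + mY +_) (forward-move [] ms x ys) ⟩
    (d + mM + b + mY) + ((# (x ⇒?_) (ms ++ ys) + t) + i)
      ≡⟨ rhs mM b mY d (# (x ⇒?_) (ms ++ ys)) t i ⟩
    (d + # (x ⇒?_) (ms ++ ys)) + ((mM + mY) + t) + (b + i)
      ≡⟨ cong₂ _+_ (cong₂ _+_ (#-++ (x ⇒?_) [ m ] (ms ++ ys)) (cong (_+ t) (#-++ (m ⇒?_) ms ys)))
           (trans (#-++ (_⇒? x) [ m ] ms) (cong (_+ i) (sym (#-flip m x)))) ⟨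
    # (x ⇒?_) (m ∷ ms ++ ys) + (# (m ⇒?_) (ms ++ ys) + t) + # (_⇒? x) (m ∷ ms) ∎
    where
    open ≡-Reasoning
    s = forward (ms ++ x ∷ ys)
    t = forward (ms ++ ys)
    mM = # (m ⇒?_) ms
    mY = # (m ⇒?_) ys
    b = # (m ⇒?_) [ x ]
    d = # (x ⇒?_) [ m ]
    e = # (x ⇒?_) ms
    i = # (_⇒? x) ms
    lhs : ∀ a b c s d e → (a + (b + c)) + s + (d + e) ≡ (d + a + b + c) + (s + e)
    lhs = solve-∀
    rhs : ∀ a b c d h t i → (d + a + b + c) + ((h + t) + i) ≡ (d + h) + ((a + c) + t) + (b + i)
    rhs = solve-∀
  forward-move (w ∷ ws) ms x ys = begin
    p + s + # (x ⇒?_) ms    ≡⟨ +-assoc p s _ ⟩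
    p + (s + # (x ⇒?_) ms)  ≡⟨ cong₂ _+_ (#-↭ (w ⇒?_) (++⁺ˡ ws (shift x ms ys))) (forward-move ws ms x ys) ⟩
    q + (t + # (_⇒? x) ms)  ≡⟨ +-assoc q t _ ⟨
    q + t + # (_⇒? x) ms    ∎
    where
    open ≡-Reasoning
    s = forward (ws ++ ms ++ x ∷ ys)
    t = forward (ws ++ x ∷ ms ++ ys)
    p = # (w ⇒?_) (ws ++ ms ++ x ∷ ys)
    q = # (w ⇒?_) (ws ++ x ∷ ms ++ ys)

  module _ (vs : List A) where

    record IsMedianOrder (xs : List A) : Set where
      constructor median
      field
        ordering : xs ↭ vs
        maximal  : ∀ {ys} → ys ↭ vs → forward ys ≤ forward xs

    -- `forward` is bounded on the orderings of `vs`, so improvements must stop. The double negation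
    -- spares a search through all permutations.
    ¬¬∃-medianOrder : ¬ ¬ (∃[ xs ] IsMedianOrder xs)
    ¬¬∃-medianOrder none = climb (length vs * length vs) vs ↭-refl (m≤m+n _ _)
      where
      -- `k` bounds the number of improvements that are still possible.
      climb : ∀ k xs → xs ↭ vs → ¬ (length vs * length vs ≤ k + forward xs)
      climb zero xs xs↭vs full = none (xs , median xs↭vs λ {ys} ys↭vs → ≤-trans
        (subst (λ l → forward ys ≤ l * l) (↭-length ys↭vs) (forward-bounded ys)) full)
      climb (suc k) xs xs↭vs gap = none (xs , median xs↭vs λ {ys} ys↭vs → ≮⇒≥ λ lt →
        climb k ys ys↭vs (begin
          length vs * length vs  ≤⟨ gap ⟩
          suc k + forward xs     ≡⟨ +-suc k (forward xs) ⟨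
          k + suc (forward xs)   ≤⟨ +-monoʳ-≤ k lt ⟩
          k + forward ys         ∎))
        where open ≤-Reasoning

    module _ ws ms {x ys} (L-median : IsMedianOrder (ws ++ ms ++ x ∷ ys)) where
      open IsMedianOrder L-median

      private
        moved : ws ++ x ∷ ms ++ ys ↭ vs
        moved = ↭-trans (++⁺ˡ ws (↭-sym (shift x ms ys))) ordering

      out≤in : # (x ⇒?_) ms ≤ # (_⇒? x) ms
      out≤in = +-cancelˡ-≤ (forward (ws ++ ms ++ x ∷ ys)) _ _ (begin
        _ ≡⟨ forward-move ws ms x ys ⟩
        _ ≤⟨ +-monoˡ-≤ (# (_⇒? x) ms) (maximal moved) ⟩
        _ ∎)
        where open ≤-Reasoning

      -- Together with `out≤in` the hypothesis makes the move leave `forward` unchanged, so the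
      -- maximum is still attained.
      median-move : # (_⇒? x) ms ≤ # (x ⇒?_) ms → IsMedianOrder (ws ++ x ∷ ms ++ ys)
      median-move in≤out = median moved λ ys↭vs → ≤-trans (maximal ys↭vs)
        (+-cancelʳ-≤ (# (x ⇒?_) ms) _ _ (begin
        _ ≡⟨ forward-move ws ms x ys ⟩
        _ ≤⟨ +-monoʳ-≤ (forward (ws ++ x ∷ ms ++ ys)) in≤out ⟩
        _ ∎))
        where open ≤-Reasoning

    -- Sedimentation of the last vertex.

    module Sedimentation
      {Out Good Kept : Pred A 0ℓ}
      (Out? : Decidable Out) (Good? : Decidable Good) (Kept? : Decidable Kept)
      (Out⇒Kept : ∀ {x} → Out x → Kept x)
      (f : A)
      where

      -- The property of x that makes moving x in front of a block of kept
      -- vertices compare the numbers of Out and Good vertices in the block.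
      Crosses : Pred A 0ℓ
      Crosses x = ∀ {y} → Kept y → (Out y → x ⇒ y) × (y ⇒ x → Good y)

      module _ {x} (x-crosses : Crosses x) {ms} (kept : All Kept ms) where

        crosses⇒out : # Out? ms ≤ # (x ⇒?_) ms
        crosses⇒out = #-mono Out? (x ⇒?_) (All.map (proj₁ ∘ x-crosses) kept)

        crosses⇒in : # (_⇒? x) ms ≤ # Good? ms
        crosses⇒in = #-mono (_⇒? x) Good? (All.map (proj₂ ∘ x-crosses) kept)

      module _ (f-crosses : Crosses f) where

        Sedimented : (ws ms rs : List A) → Set
        Sedimented ws ms rs =
          # Out? ms + # Out? rs ≤ # Good? ms + # Good? rs ×
          IsMedianOrder (ws ++ filter (¬? ∘ Kept?) rs ++ f ∷ ms ++ filter Kept? rs)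

        -- The scan of `rs` collects kept vertices in the block `ms`. If the block has no surplus of
        -- good vertices, a vertex `x` that is not kept can jump in front of it: the arcs from `ms`
        -- to `x` are at most the good vertices, these at most the `Out` vertices, and these at most
        -- the arcs from `x` to `ms`. Finally `f` meets the last block, where maximality gives the
        -- inequality and absence of a surplus allows the jump. A strict surplus anywhere decides
        -- the outcome, so no order is returned then.
        sediment : ∀ ws ms rs → All Kept ms → All (λ x → ¬ Kept x → Crosses x) rs →
          IsMedianOrder (ws ++ ms ++ rs ++ [ f ]) →
          # Out? ms + # Out? rs < # Good? ms + # Good? rs ⊎ Sedimented ws ms rs
        sediment ws ms [] kept [] L with # Out? ms <? # Good? ms
        ... | yes lt = inj₁ (+-monoˡ-< 0 lt)
        ... | no ≮   = inj₂ (+-monoˡ-≤ 0 (≤-trans out (≤-trans (out≤in ws ms L) inn)) ,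
                             median-move ws ms L (≤-trans inn (≤-trans (≮⇒≥ ≮) out)))
          where
          out = crosses⇒out f-crosses kept
          inn = crosses⇒in f-crosses kept
        sediment ws ms (x ∷ rs) kept (x-crosses ∷ crosses) L with Kept? x
        ... | yes Kx = [ inj₁ ∘ subst₂ _<_ (shunt Out?) (shunt Good?) , (λ (le , L′) → inj₂
                         ( subst₂ _≤_ (shunt Out?) (shunt Good?) le
                         , subst IsMedianOrder (cong (λ zs → ws ++ _ ++ f ∷ zs) (++-assoc ms [ x ] _)) L′)) ]′
                       (sediment ws (ms ++ [ x ]) rs (All-++⁺ kept (Kx ∷ [])) crosses
                         (subst IsMedianOrder (cong (ws ++_) (sym (++-assoc ms [ x ] _))) L))
          where
          shunt : {P : Pred A 0ℓ} (P? : Decidable P) → # P? (ms ++ [ x ]) + # P? rs ≡ # P? ms + # P? (x ∷ rs)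
          shunt P? = trans (cong (_+ # P? rs) (#-++ P? ms [ x ]))
            (trans (+-assoc (# P? ms) _ _) (cong (# P? ms +_) (sym (#-++ P? [ x ] rs))))
        ... | no ¬Kx = go (# Out? ms <? # Good? ms)
          where
          x↷ = x-crosses ¬Kx
          outs : # Out? rs ≡ # Out? (x ∷ rs)
          outs = cong length (sym (filter-reject Out? (¬Kx ∘ Out⇒Kept)))
          goods : # Good? rs ≤ # Good? (x ∷ rs)
          goods = ≤-trans (m≤n+m _ (# Good? [ x ])) (≤-reflexive (sym (#-++ Good? [ x ] rs)))
          -- A strict surplus in ms is kept by starting afresh after x.
          go : Dec (# Out? ms < # Good? ms) →
               # Out? ms + # Out? (x ∷ rs) < # Good? ms + # Good? (x ∷ rs) ⊎
               (# Out? ms + # Out? (x ∷ rs) ≤ # Good? ms + # Good? (x ∷ rs) ×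
                IsMedianOrder (ws ++ (x ∷ filter (¬? ∘ Kept?) rs) ++ f ∷ ms ++ filter Kept? rs))
          go (yes lt) = inj₁ (+-mono-<-≤ lt (≤-trans (≤-reflexive (sym outs)) (≤-trans rest goods)))
            where
            rest : # Out? rs ≤ # Good? rs
            rest = [ <⇒≤ , proj₁ ]′ (sediment (ws ++ ms ++ [ x ]) [] rs [] crosses
              (subst IsMedianOrder (sym (trans (++-assoc ws _ _) (cong (ws ++_) (++-assoc ms _ _)))) L))
          go (no ≮) = [ (λ lt → inj₁ (subst (λ o → # Out? ms + o < _) outs (<-≤-trans lt (+-monoʳ-≤ (# Good? ms) goods))))
                      , (λ (le , L′) → inj₂ ( subst (λ o → # Out? ms + o ≤ _) outs (≤-trans le (+-monoʳ-≤ (# Good? ms) goods))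
                                            , subst IsMedianOrder (++-assoc ws [ x ] _) L′)) ]′
                      (sediment (ws ++ [ x ]) ms rs kept crosses
                        (subst IsMedianOrder (sym (++-assoc ws [ x ] _))
                          (median-move ws ms L (≤-trans (crosses⇒in x↷ kept) (≤-trans (≮⇒≥ ≮) (crosses⇒out x↷ kept))))))

-- Cardinalities of subsets, and second out-neighbours as paths.

module _ {P : Pred (Fin n) 0ℓ} (P? : Decidable P) where

  ∈⟪⟫⁺ : ∀ {u} → P u → u ∈ₛ ⟪ P? ⟫
  ∈⟪⟫⁺ {u} Pu = lookup⇒[]= u _ (trans (lookup∘tabulate (does ∘ P?) u) (dec-true (P? u) Pu))

  ∈⟪⟫⁻ : ∀ {u} → u ∈ₛ ⟪ P? ⟫ → P u
  ∈⟪⟫⁻ {u} u∈ with P? u | trans (sym (lookup∘tabulate (does ∘ P?) u)) ([]=⇒lookup u∈)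
  ... | yes Pu | _ = Pu

#-tabulate : ∀ {A : Set} {P : Pred A 0ℓ} (P? : Decidable P) (g : Fin n → A) →
             # P? (tabulateₗ g) ≡ ∣ ⟪ P? ∘ g ⟫ ∣
#-tabulate {zero}  P? g = refl
#-tabulate {suc n} P? g with does (P? (g zero))
... | true  = cong suc (#-tabulate P? (g ∘ suc))
... | false = #-tabulate P? (g ∘ suc)

∣tabulate∣-punchIn : ∀ (b : Fin (suc n) → Bool) z → ∣ tabulate b ∣ ≡ ∣ b z ∷ tabulate (b ∘ punchIn z) ∣
∣tabulate∣-punchIn b zero = refl
∣tabulate∣-punchIn {suc n} b (suc z) with b zero | b (suc z) | ∣tabulate∣-punchIn (b ∘ suc) z
... | true  | true  | eq = cong suc eq
... | true  | false | eq = cong suc eq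
... | false | true  | eq = eq
... | false | false | eq = eq

∣p∪⁅x⁆∣≤1+∣p∣ : ∀ (p : Subset n) x → ∣ p ∪ ⁅ x ⁆ ∣ ≤ suc ∣ p ∣
∣p∪⁅x⁆∣≤1+∣p∣ (inside  ∷ p) zero    = s≤s (≤-trans (≤-reflexive (cong ∣_∣ (∪-identityʳ p))) (n≤1+n _))
∣p∪⁅x⁆∣≤1+∣p∣ (outside ∷ p) zero    = s≤s (≤-reflexive (cong ∣_∣ (∪-identityʳ p)))
∣p∪⁅x⁆∣≤1+∣p∣ (inside  ∷ p) (suc x) = s≤s (∣p∪⁅x⁆∣≤1+∣p∣ p x)
∣p∪⁅x⁆∣≤1+∣p∣ (outside ∷ p) (suc x) = ∣p∪⁅x⁆∣≤1+∣p∣ p x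

-- Finitely many instances of excluded middle hold jointly under one double negation. This serves
-- `Oriented`, an inductive relation without a decision procedure here.
¬¬-decidable : ∀ {m n} (R : Fin m → Fin n → Set) → ¬ ¬ (∀ i j → Dec (R i j))
¬¬-decidable R = sequence app λ i → sequence app λ j → ¬¬-excluded-middle
  where app = RawMonad.rawApplicative ¬¬-Monad

module _ (G : Digraph n) where
  open Digraph G

  second⁺ : ∀ {v c u} → u ≢ v → ¬ (v ⟶ u) → v ⟶ c → c ⟶ u → IsSecondOutNeighbour G v u
  second⁺ {v} {c} u≢v v↛u v→c c→u =
    [ u≢v ∘ x∈⁅y⁆⇒x≡y v , v↛u ∘ ∈⟪⟫⁻ (v ⟶?_) ]′ ∘ x∈p∪q⁻ ⁅ v ⁆ (N⁺ G v) ,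
    c , x∈p∩q⁺ (∈⟪⟫⁺ (_⟶? _) c→u , ∈⟪⟫⁺ (v ⟶?_) v→c)

  second⁻ : ∀ {v u} → IsSecondOutNeighbour G v u →
            u ≢ v × ¬ (v ⟶ u) × ∃[ c ] (v ⟶ c × c ⟶ u)
  second⁻ {v} {u} (u∉ , c , c∈) =
    (λ where refl → u∉ (x∈p∪q⁺ (inj₁ (x∈⁅x⁆ v)))) ,
    (λ v→u → u∉ (x∈p∪q⁺ (inj₂ (∈⟪⟫⁺ (v ⟶?_) v→u)))) ,
    c , ∈⟪⟫⁻ (v ⟶?_) (proj₂ (x∈p∩q⁻ _ _ c∈)) , ∈⟪⟫⁻ (_⟶? u) (proj₁ (x∈p∩q⁻ _ _ c∈))

-- Losing relations between missing edges, and their orientation.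

module TournamentMissingMatching (D : Digraph n) (isTMM : IsTournamentMissingMatching D) where
  open Digraph D
  open IsTournamentMissingMatching isTMM
  open IsOriented isOriented

  Missing : Rel (Fin n) 0ℓ
  Missing = MissingEdge D

  private
    variable
      a b f g q u v x y : Fin n

  missing-sym : Missing x y → Missing y x
  missing-sym (x≢y , x↛y , y↛x) = ≢-sym x≢y , y↛x , x↛y

  adjacent⊎missing : x ≢ y → x ⟶ y ⊎ y ⟶ x ⊎ Missing x y
  adjacent⊎missing {x} {y} x≢y with x ⟶? y | y ⟶? x
  ... | yes x→y | _       = inj₁ x→y
  ... | no _    | yes y→x = inj₂ (inj₁ y→x)
  ... | no x↛y  | no y↛x  = inj₂ (inj₂ (x≢y , x↛y , y↛x))

  data Reach (x y : Fin n) : Set where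
    one : x ⟶ y → Reach x y
    two : ∀ {c} → x ⟶ c → c ⟶ y → Reach x y

  reach? : Binary.Decidable Reach
  reach? x y with x ⟶? y | any? (λ c → x ⟶? c ×-dec c ⟶? y)
  ... | yes x→y | _                     = yes (one x→y)
  ... | no _    | yes (c , x→c , c→y)   = yes (two x→c c→y)
  ... | no x↛y  | no ∄c                 = no λ where
    (one x→y)     → x↛y x→y
    (two x→c c→y) → ∄c (_ , x→c , c→y)

  reach⇒second : x ≢ f → Reach f x → ¬ (f ⟶ x) → IsSecondOutNeighbour D f x
  reach⇒second x≢f (one f→x)     f↛x = contradiction f→x f↛x
  reach⇒second x≢f (two f→c c→x) f↛x = second⁺ D x≢f f↛x f→c c→x

  -- The usual test for orienting a missing edge: with an arc from `a` to `b` added, no in-neighbour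
  -- of `a` gains `b` as a second out-neighbour.
  Convenient : Rel (Fin n) 0ℓ
  Convenient a b = ∀ {q} → q ⟶ a → Reach q b

  -- The missing edge xy loses to the missing edge ab.  Each missing edge loses
  -- to at most one and is beaten by at most one; exactly the missing edges that
  -- are convenient in neither direction are beaten.
  record Loses (x y a b : Fin n) : Set where
    constructor loses
    field
      missing₂ : Missing a b
      x→a      : x ⟶ a
      x↛b      : ¬ Reach x b
      y→b      : y ⟶ b
      y↛a      : ¬ Reach y a

    missing₁ : Missing x y
    missing₁ = (λ where refl → x↛b (one y→b)) , (λ x→y → x↛b (two x→y y→b)) , (λ y→x → y↛a (two y→x x→a))

  loses-swap : Loses x y a b → Loses y x b a
  loses-swap (loses ab x→a x↛b y→b y↛a) = loses (missing-sym ab) y→b y↛a x→a x↛b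

  -- If `v` and `x` differ, nothing can hold between `x` and `u`: an arc to `u` lets `f` reach `u`,
  -- an arc to `x` lets `g` reach `x`, and a missing edge violates the matching condition at `u`.
  loses-unique : Loses f g v u → Loses f g x y → u ≡ y
  loses-unique {f} {g} {v} {u} {x} {y} (loses vu f→v f↛u g→u g↛v) (loses xy f→x f↛y g→y g↛x) with v ≟ x
  ... | yes refl = matching v u y vu xy
  ... | no v≢x with adjacent⊎missing {x} {u} (λ { refl → f↛u (one f→x) })
  ...   | inj₁ x→u        = contradiction (two f→x x→u) f↛u
  ...   | inj₂ (inj₁ u→x) = contradiction (two g→u u→x) g↛x
  ...   | inj₂ (inj₂ xu)  = contradiction (matching u v x (missing-sym vu) (missing-sym xu)) v≢x

  -- `g` does not reach `v`, and a missing edge `vg` would force `v` to be `f`. Applied to the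
  -- swapped loss this also gives `u ⟶ f`, closing the 4-cycle `f`, `v`, `g`, `u`.
  loses⇒cycle : Loses f g v u → v ⟶ g
  loses⇒cycle {f} {g} {v} {u} l@(loses vu f→v f↛u g→u g↛v)
    with missing₁ ← Loses.missing₁ l
    with adjacent⊎missing {v} {g} (λ { refl → proj₁ (proj₂ missing₁) f→v })
  ... | inj₁ v→g        = v→g
  ... | inj₂ (inj₁ g→v) = contradiction (one g→v) g↛v
  ... | inj₂ (inj₂ vg)  with refl ← matching g v f (missing-sym vg) (missing-sym missing₁) =
    contradiction f→v (noLoops refl)

  loses⇒second : Loses f g v u → IsSecondOutNeighbour D f g
  loses⇒second l = second⁺ D (≢-sym (proj₁ missing₁)) (proj₁ (proj₂ missing₁)) x→a (loses⇒cycle l)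
    where open Loses l

  -- With an arc from `g` to `x`, every relation between `v` and `x` fails, the missing edge because
  -- the partner of `v` is `u`.
  loses⇒no-arc : Loses f g v u → x ≢ u → ¬ Reach f x → ¬ (g ⟶ x)
  loses⇒no-arc {f} {g} {v} {u} {x} (loses vu f→v f↛u g→u g↛v) x≢u f↛x g→x
    with adjacent⊎missing {v} {x} (λ { refl → f↛x (one f→v) })
  ... | inj₁ v→x        = f↛x (two f→v v→x)
  ... | inj₂ (inj₁ x→v) = g↛v (two g→x x→v)
  ... | inj₂ (inj₂ vx)  = x≢u (matching v x u vx vu)

  -- Edges convenient in exactly one direction are oriented that way, and the
  -- orientation is transported along Loses.  Edges convenient both ways, and the
  -- edges on cycles of Loses, remain unoriented.
  data Oriented : Rel (Fin n) 0ℓ where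
    start : Missing a b → Convenient a b → ¬ Convenient b a → Oriented a b
    next  : Loses x y a b → Oriented x y → Oriented a b

  oriented⇒missing : Oriented a b → Missing a b
  oriented⇒missing (start ab _ _) = ab
  oriented⇒missing (next l _)     = Loses.missing₂ l

  -- Such a `q` can replace `x` in the loss, so `q` and `x` are both matched to `y`.
  witness-unique : Loses x y a b → q ⟶ a → ¬ Reach q b → q ≡ x
  witness-unique l@(loses ab x→a x↛b y→b y↛a) q→a q↛b =
    matching _ _ _ (missing-sym (Loses.missing₁ (loses ab q→a q↛b y→b y↛a))) (missing-sym (Loses.missing₁ l))

  -- A missing edge that another loses to is convenient in neither direction, so `start` and `next`
  -- never meet. Two uses of `next` come from the same edge in opposite directions, and induction
  -- applies.
  oriented-asym : Oriented a b → ¬ Oriented b a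
  oriented-asym (start _ conv _) (start _ _ ¬conv) = ¬conv conv
  oriented-asym (start _ conv _) (next l _)        = Loses.y↛a l (conv (Loses.y→b l))
  oriented-asym (next l _) (start _ conv _)        = Loses.y↛a l (conv (Loses.y→b l))
  oriented-asym (next l o) (next l′ o′)
    with refl ← witness-unique l (Loses.y→b l′) (Loses.y↛a l′)
       | refl ← witness-unique l′ (Loses.y→b l) (Loses.y↛a l) = oriented-asym o o′

  oriented⇒loses : Oriented y x → f ⟶ y → ¬ Reach f x → ∃[ q ] (Loses f q y x × Oriented f q)
  oriented⇒loses (start _ conv _) f→y f↛x = contradiction (conv f→y) f↛x
  oriented⇒loses (next l o)       f→y f↛x with refl ← witness-unique l f→y f↛x = _ , l , o

  -- `f` refutes convenience from `y` to `x`; an in-neighbour of `x` refuting the other direction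
  -- would form, with `f`, a missing edge that loses to `yx`.
  convenient⁺ : Missing x y → f ⟶ y → ¬ Reach f x → (∀ {q} → ¬ Loses f q y x) → Oriented x y
  convenient⁺ {x} {y} xy f→y f↛x winless = start xy
    (λ {q} q→x → decidable-stable (reach? q y) λ q↛y → winless (loses (missing-sym xy) f→y f↛x q→x q↛y))
    (λ conv → f↛x (conv f→y))

  _⇒_ : Rel (Fin n) 0ℓ
  x ⇒ y = x ⟶ y ⊎ Oriented x y

  -- Feeds: what sedimentation needs to know about the last vertex.

  module _ (oriented? : Binary.Decidable Oriented) where

    _⇒?_ : Binary.Decidable _⇒_
    x ⇒? y = x ⟶? y ⊎-dec oriented? x y

    open MedianOrder _⇒?_

    -- `Good` is not fixed as `N⁺⁺ D f`, since only its size matters for the inequality.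
    -- `second⇒kept` serves the descent, where vertices of `N⁺⁺ D f` must land behind `f`.
    record Feed (f : Fin n) : Set₁ where
      field
        {Good Kept} : Pred (Fin n) 0ℓ
        good?       : Decidable Good
        kept?       : Decidable Kept
        out⇒kept    : f ⟶ x → Kept x
        second⇒kept : IsSecondOutNeighbour D f x → Kept x
        ∣good∣≤     : ∣ ⟪ good? ⟫ ∣ ≤ ∣ N⁺⁺ D f ∣

      open Sedimentation (allFin n) (f ⟶?_) good? kept? out⇒kept f public

      field
        feed-crosses  : Crosses f
        other-crosses : x ≢ f → ¬ Kept x → Crosses x

    -- If `fg` loses to `vu`, its orientation towards `f` is transported to `u ⇒ v`, just as
    -- crossing requires of the vertex `u` that `f` does not reach.
    plain-feed : (∀ {g v u} → Loses f g v u → Oriented g f) → Feed f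
    plain-feed {f} oriented = record
      { Good          = IsSecondOutNeighbour D f
      ; Kept          = λ x → f ⟶ x ⊎ IsSecondOutNeighbour D f x
      ; good?         = isSecondOutNeighbour? D f
      ; kept?         = λ x → f ⟶? x ⊎-dec isSecondOutNeighbour? D f x
      ; out⇒kept      = inj₁
      ; second⇒kept   = inj₂
      ; ∣good∣≤       = ≤-refl
      ; feed-crosses  = λ kept → inj₁ , λ y⇒f → [ (λ f→y → contradiction f→y (not-out y⇒f)) , id ]′ kept
      ; other-crosses = λ {x} x≢f ¬kept {y} kept →
          let f↛x = λ r → ¬kept (inj₂ (reach⇒second x≢f r (¬kept ∘ inj₁)))
          in (λ f→y → out f→y f↛x) , λ y⇒x → [ (λ f→y → contradiction f→y (inn y⇒x f↛x)) , id ]′ kept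
      }
      where
      not-out : y ⇒ f → ¬ (f ⟶ y)
      not-out (inj₁ y→f) f→y = noDigons f→y y→f
      not-out (inj₂ o)   f→y = proj₂ (proj₂ (oriented⇒missing o)) f→y
      inn : y ⇒ x → ¬ Reach f x → ¬ (f ⟶ y)
      inn (inj₁ y→x) f↛x f→y = f↛x (two f→y y→x)
      inn (inj₂ o)   f↛x f→y with _ , l , o′ ← oriented⇒loses o f→y f↛x = oriented-asym o′ (oriented l)
      out : f ⟶ y → ¬ Reach f x → x ⇒ y
      out {y} {x} f→y f↛x with adjacent⊎missing {x} {y} (λ { refl → f↛x (one f→y) })
      ... | inj₁ x→y        = inj₁ x→y
      ... | inj₂ (inj₁ y→x) = contradiction (two f→y y→x) f↛x
      -- Either some missing edge at `f` loses to `yx` and transport orients `xy`, or none does and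
      -- convenience orients it.
      ... | inj₂ (inj₂ xy)  = inj₂ (decidable-stable (oriented? x y) λ ¬o →
        ¬o (convenient⁺ xy f→y f↛x λ l → ¬o (next (loses-swap l) (oriented l))))

    -- The missing edge vu may be unoriented, so v ∈ N⁺ f could spoil u as a
    -- vertex that crosses.  Hence u is kept and counted as good in place of
    -- g ∈ N⁺⁺ f; leaving g uncounted is harmless because neither f nor any
    -- vertex that crosses is entered from g.
    exchange-feed : Loses f g v u → ¬ Oriented g f → Feed f
    exchange-feed {f} {g} {v} {u} l ¬oriented = record
      { Good          = Good
      ; Kept          = λ x → f ⟶ x ⊎ IsSecondOutNeighbour D f x ⊎ x ≡ u
      ; good?         = good?
      ; kept?         = λ x → f ⟶? x ⊎-dec isSecondOutNeighbour? D f x ⊎-dec x ≟ u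
      ; out⇒kept      = inj₁
      ; second⇒kept   = inj₂ ∘ inj₁
      ; ∣good∣≤       = ∣good∣≤
      ; feed-crosses  = λ kept → inj₁ , λ where
          (inj₁ y→f) → good kept (λ f→y → noDigons f→y y→f) λ where refl → proj₂ (proj₂ missing₁) y→f
          (inj₂ o)   → good kept (proj₂ (proj₂ (oriented⇒missing o))) λ where refl → ¬oriented o
      ; other-crosses = λ {x} x≢f ¬kept {y} kept →
          let f↛x = λ r → ¬kept (inj₂ (inj₁ (reach⇒second x≢f r (¬kept ∘ inj₁))))
              x≢u = ¬kept ∘ inj₂ ∘ inj₂
          in (λ f→y → out f→y f↛x x≢u) , inn kept x≢f f↛x x≢u
      }
      where
      open Loses l using (missing₁)
      Good : Pred (Fin n) 0ℓ
      Good y = (IsSecondOutNeighbour D f y × y ≢ g) ⊎ y ≡ u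
      good? : Decidable Good
      good? y = (isSecondOutNeighbour? D f y ×-dec ¬? (y ≟ g)) ⊎-dec (y ≟ u)
      good : f ⟶ y ⊎ IsSecondOutNeighbour D f y ⊎ y ≡ u → ¬ (f ⟶ y) → y ≢ g → Good y
      good (inj₁ f→y)      f↛y y≢g = contradiction f→y f↛y
      good (inj₂ (inj₁ s)) f↛y y≢g = inj₁ (s , y≢g)
      good (inj₂ (inj₂ e)) f↛y y≢g = inj₂ e
      ∣good∣≤ : ∣ ⟪ good? ⟫ ∣ ≤ ∣ N⁺⁺ D f ∣
      ∣good∣≤ = begin
        ∣ ⟪ good? ⟫ ∣                ≤⟨ p⊆q⇒∣p∣≤∣q∣ included ⟩
        ∣ (N⁺⁺ D f - g) ∪ ⁅ u ⁆ ∣    ≤⟨ ∣p∪⁅x⁆∣≤1+∣p∣ (N⁺⁺ D f - g) u ⟩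
        suc ∣ N⁺⁺ D f - g ∣          ≤⟨ x∈p⇒∣p-x∣<∣p∣ (∈⟪⟫⁺ (isSecondOutNeighbour? D f) (loses⇒second l)) ⟩
        ∣ N⁺⁺ D f ∣                  ∎
        where
        open ≤-Reasoning
        included : ⟪ good? ⟫ ⊆ (N⁺⁺ D f - g) ∪ ⁅ u ⁆
        included y∈ with ∈⟪⟫⁻ good? y∈
        ... | inj₁ (s , y≢g) = x∈p∪q⁺ (inj₁ (x∈p∧x≢y⇒x∈p-y (∈⟪⟫⁺ (isSecondOutNeighbour? D f) s) y≢g))
        ... | inj₂ refl      = x∈p∪q⁺ (inj₂ (x∈⁅x⁆ u))
      -- The only missing edge at `f` is `fg`, and it loses to `vu` alone.
      only-u : ¬ Reach f x → x ≢ u → ∀ {q} → ¬ Loses f q y x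
      only-u f↛x x≢u l′ with refl ← matching f _ _ (Loses.missing₁ l′) missing₁ = x≢u (loses-unique l′ l)
      out : f ⟶ y → ¬ Reach f x → x ≢ u → x ⇒ y
      out {y} {x} f→y f↛x x≢u with adjacent⊎missing {x} {y} (λ { refl → f↛x (one f→y) })
      ... | inj₁ x→y        = inj₁ x→y
      ... | inj₂ (inj₁ y→x) = contradiction (two f→y y→x) f↛x
      ... | inj₂ (inj₂ xy)  = inj₂ (convenient⁺ xy f→y f↛x (only-u f↛x x≢u))
      inn : f ⟶ y ⊎ IsSecondOutNeighbour D f y ⊎ y ≡ u → x ≢ f → ¬ Reach f x → x ≢ u → y ⇒ x → Good y
      inn kept x≢f f↛x x≢u (inj₁ y→x) =
        good kept (λ f→y → f↛x (two f→y y→x)) λ where refl → loses⇒no-arc l x≢u f↛x y→x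
      inn kept x≢f f↛x x≢u (inj₂ o) =
        good kept (λ f→y → only-u f↛x x≢u (proj₁ (proj₂ (oriented⇒loses o f→y f↛x))))
          λ where refl → x≢f (matching g _ _ (oriented⇒missing o) (missing-sym missing₁))

    -- A loss not oriented towards `f` gives an exchange feed; if there is none, the plain feed
    -- applies.
    ¬¬feed : ∀ f → ¬ ¬ Feed f
    ¬¬feed f none = none (plain-feed λ l → decidable-stable (oriented? _ _) (none ∘ exchange-feed l))

    -- List counts become cardinalities: `f` is not its own out-neighbour, and omitting it can only
    -- lower the count of good vertices.
    feed-median : ∀ {f rest w} → IsMedianOrder (allFin n) (rest ++ [ f ]) → Feed f →
      ∣ N⁺ D f ∣ < ∣ N⁺⁺ D f ∣ ⊎
      HasLargeSecondNeighbourhood D f ×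
      (f ⟶ w ⊎ IsSecondOutNeighbour D f w →
       ∃[ xs ] (IsMedianOrder (allFin n) xs × after _≟_ w xs < after _≟_ w (rest ++ [ f ])))
    feed-median {f} {rest} {w} L F =
      [ (λ lt → inj₁ (subst (_< _) outs (<-≤-trans lt goods)))
      , (λ (le , L′) → inj₂ (subst (_≤ _) outs (≤-trans le goods) , λ reached → _ , L′ , later reached)) ]′
      (sediment feed-crosses [] [] rest [] (All.map other-crosses rest≢f) L)
      where
      open Feed F
      f∷rest↭ : f ∷ rest ↭ allFin n
      f∷rest↭ = ↭-trans (∷↭∷ʳ f rest) (IsMedianOrder.ordering L)
      f∷rest-unique : Unique (f ∷ rest)
      f∷rest-unique = Permutation.Unique-resp-↭ (setoid (Fin n)) (↭⇒↭ₛ (↭-sym f∷rest↭)) (allFin⁺ n)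
      rest≢f : All (_≢ f) rest
      rest≢f with f≢ ∷ _ ← f∷rest-unique = All.map ≢-sym f≢
      total : {P : Pred (Fin n) 0ℓ} (P? : Decidable P) → # P? [ f ] + # P? rest ≡ ∣ ⟪ P? ⟫ ∣
      total P? = trans (sym (#-++ P? [ f ] rest)) (trans (#-↭ P? f∷rest↭) (#-tabulate P? id))
      outs : # (f ⟶?_) rest ≡ ∣ N⁺ D f ∣
      outs = trans (cong (_+ # (f ⟶?_) rest) (sym (#-none (f ⟶?_) (noLoops refl)))) (total (f ⟶?_))
      goods : # good? rest ≤ ∣ N⁺⁺ D f ∣
      goods = ≤-trans (m≤n+m _ (# good? [ f ])) (≤-trans (≤-reflexive (total good?)) ∣good∣≤)
      later : f ⟶ w ⊎ IsSecondOutNeighbour D f w →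
        after _≟_ w (filter (¬? ∘ kept?) rest ++ f ∷ filter kept? rest) < after _≟_ w (rest ++ [ f ])
      -- `w` is kept, so it now stands behind `f`. The strict drop is due to `f`, which stood behind
      -- `w` before.
      later reached = begin-strict
        after _≟_ w (filter (¬? ∘ kept?) rest ++ f ∷ filter kept? rest)
          ≡⟨ after-++-∉ _≟_ (filter (¬? ∘ kept?) rest) (λ w∈ → proj₂ (∈-filter⁻ (¬? ∘ kept?) {xs = rest} w∈) kept) ⟩
        after _≟_ w (f ∷ filter kept? rest)
          ≡⟨ after-++-∉ _≟_ [ f ] (λ where (here w≡f) → w≢f w≡f) ⟩
        after _≟_ w (filter kept? rest)
          ≤⟨ after-filter _≟_ kept? kept rest ⟩
        after _≟_ w rest
          <⟨ n<1+n _ ⟩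
        suc (after _≟_ w rest)
          ≡⟨ after-∷ʳ _≟_ f w∈rest ⟨
        after _≟_ w (rest ++ [ f ]) ∎
        where
        open ≤-Reasoning
        kept : Kept w
        kept = [ out⇒kept , second⇒kept ]′ reached
        w≢f : w ≢ f
        w≢f = [ (λ f→w w≡f → noLoops (sym w≡f) f→w) , proj₁ ∘ second⁻ D ]′ reached
        w∈rest : w ∈ rest
        w∈rest with ∈-resp-↭ (↭-sym f∷rest↭) (∈-allFin w)
        ... | here w≡f = contradiction w≡f w≢f
        ... | there w∈ = w∈

-- Passing from `D` to `H`.

module DeletedVertex {n} (H : Digraph (suc n)) (z : Fin (suc n)) (H-oriented : IsOriented H) where
  open Digraph H
  open IsOriented H-oriented

  private
    D = H -[ z ]
    variable
      f w : Fin n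

  trace : Fin n → Subset n
  trace f = ⟪ isSecondOutNeighbour? H (punchIn z f) ∘ punchIn z ⟫

  second⇒second : ∀ {u} → IsSecondOutNeighbour D f u → IsSecondOutNeighbour H (punchIn z f) (punchIn z u)
  second⇒second s with u≢f , f↛u , c , f→c , c→u ← second⁻ D s =
    second⁺ H (u≢f ∘ punchIn-injective z _ _) f↛u f→c c→u

  N⁺⁺⊆trace : N⁺⁺ D f ⊆ trace f
  N⁺⁺⊆trace {f} u∈ = ∈⟪⟫⁺ (isSecondOutNeighbour? H (punchIn z f) ∘ punchIn z)
    (second⇒second (∈⟪⟫⁻ (isSecondOutNeighbour? D f) u∈))

  ∣trace∣≤ : ∣ trace f ∣ ≤ ∣ N⁺⁺ H (punchIn z f) ∣
  ∣trace∣≤ {f} rewrite ∣tabulate∣-punchIn (λ u → does (isSecondOutNeighbour? H (punchIn z f) u)) z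
    with does (isSecondOutNeighbour? H (punchIn z f) z)
  ... | true  = n≤1+n _
  ... | false = ≤-refl

  -- Only `z` can raise the out-degree of `f`; a surplus in `trace f` has to pay for it.
  large-unless : (punchIn z f ⟶ z → ∣ N⁺ D f ∣ < ∣ trace f ∣) → HasLargeSecondNeighbourhood D f →
                 HasLargeSecondNeighbourhood H (punchIn z f)
  large-unless {f} strict large = ≤-trans
    (subst (_≤ ∣ trace f ∣) (sym (∣tabulate∣-punchIn (λ u → does (punchIn z f ⟶? u)) z)) bound) ∣trace∣≤
    where
    bound : ∣ does (punchIn z f ⟶? z) ∷ N⁺ D f ∣ ≤ ∣ trace f ∣
    bound with punchIn z f ⟶? z
    ... | yes f→z = strict f→z
    ... | no _    = ≤-trans large (p⊆q⇒∣p∣≤∣q∣ N⁺⁺⊆trace)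

  large-strict : ∣ N⁺ D f ∣ < ∣ N⁺⁺ D f ∣ → HasLargeSecondNeighbourhood H (punchIn z f)
  large-strict lt = large-unless (λ _ → <-≤-trans lt (p⊆q⇒∣p∣≤∣q∣ N⁺⁺⊆trace)) (<⇒≤ lt)

  large-via : z ⟶ punchIn z w → HasLargeSecondNeighbourhood D f →
    ¬ (Digraph._⟶_ D f w ⊎ IsSecondOutNeighbour D f w) → HasLargeSecondNeighbourhood H (punchIn z f)
  large-via {w} {f} z→w large unreached = large-unless
    -- The path through `z` puts `w` into `trace f` but not into `N⁺⁺ D f`, so the inclusion is
    -- proper.
    (λ f→z → <-≤-trans (s≤s large) (p⊂q⇒∣p∣<∣q∣ (N⁺⁺⊆trace , w , w∈ f→z , unreached ∘ inj₂ ∘ ∈⟪⟫⁻ (isSecondOutNeighbour? D f))))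
    large
    where
    w∈ : punchIn z f ⟶ z → w ∈ₛ trace f
    w∈ f→z = ∈⟪⟫⁺ (isSecondOutNeighbour? H (punchIn z f) ∘ punchIn z)
      (second⁺ H (λ w≡f → noDigons f→z (subst (z ⟶_) w≡f z→w)) (unreached ∘ inj₁) f→z z→w)

  out-neighbour : ¬ IsSink H z → ∃[ w ] z ⟶ punchIn z w
  out-neighbour ¬sink with nonempty? (N⁺ H z)
  ... | no empty = contradiction (trans (cong ∣_∣ (Empty-unique empty)) (∣⊥∣≡0 (suc n))) ¬sink
  ... | yes (w , w∈) = punchOut z≢w , subst (z ⟶_) (sym (punchIn-punchOut z≢w)) z→w
    where
    z→w = ∈⟪⟫⁻ (z ⟶?_) w∈
    z≢w = λ z≡w → noLoops z≡w z→w

-- The descent along median orders.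

theorem6 : ∀ {n : ℕ} (H : Digraph (suc n)) (z : Fin (suc n)) →
    IsOriented H →
    (∀ v → ¬ IsSink H v) →
    IsTournamentMissingMatching (H -[ z ]) →
    ∃[ v ] (HasLargeSecondNeighbourhood (H -[ z ]) v ×
    HasLargeSecondNeighbourhood H (punchIn z v))
theorem6 {n} H z H-oriented ¬sink isTMM = decidable-stable
  (any? λ v → (∣ N⁺ D v ∣ ≤? ∣ N⁺⁺ D v ∣) ×-dec (∣ N⁺ H (punchIn z v) ∣ ≤? ∣ N⁺⁺ H (punchIn z v) ∣))
  -- The conclusion is decidable, so facts known only under a double negation may be used to refute
  -- its failure.
  λ none → ¬¬-decidable Oriented λ oriented? →
  MedianOrder.¬¬∃-medianOrder (_⇒?_ oriented?) (allFin n) λ (xs , L) →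
  descend none oriented? xs L (<-wellFounded _)
  where
  D = H -[ z ]
  open TournamentMissingMatching D isTMM
  open DeletedVertex H z H-oriented

  w = proj₁ (out-neighbour (¬sink z))
  z→w = proj₂ (out-neighbour (¬sink z))

  module _
    (none : ¬ (∃[ v ] (HasLargeSecondNeighbourhood D v × HasLargeSecondNeighbourhood H (punchIn z v))))
    (oriented? : Binary.Decidable Oriented)
    where
    open MedianOrder (_⇒?_ oriented?)

    descend : ∀ xs → IsMedianOrder (allFin n) xs → Acc _<_ (after _≟_ w xs) → ⊥
    descend xs L (acc rs) with initLast xs
    -- An order of V(D) is not empty, as it contains `w`.
    ... | [] with () ← ∈-resp-↭ (↭-sym (IsMedianOrder.ordering L)) (∈-allFin w)
    ... | rest ∷ʳ′ f = ¬¬feed oriented? f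
      ([ (λ lt → none (f , <⇒≤ lt , large-strict lt))
       , (λ (large , later) → none (f , large , large-via z→w large λ reached →
           let ys , L′ , lt = later reached in descend ys L′ (rs lt)))
       ]′ ∘ feed-median oriented? L)
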